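{- Let $n$ be a positive integer and let $G$ be a simple graph. Then $G$ is isomorphic to the friendship graph $F_n$ if and only if $$[x]\,da(G;x,y) = 2n\,y^{2n-1} +y.$$
   Context: All graphs are finite, simple and have at least one vertex. For a graph $G$, $S\subseteq V(G)$ and $u\in V(G)$, let $\bar S=V(G)\setminus S$, let $\delta_S(u)=|\{v\in S:\{u,v\}\in E(G)\}|$, and let $G[S]$ be the subgraph induced by $S$. The defensive alliance polynomial of $G$ is $$da(G;x,y)=\sum_{S} x^{|S|}\,y^{f_y(S)},\qquad f_y(S)=\min_{u\in S}\bigl(\delta_S(u)-\delta_{\bar S}(u)+|V(G)|\bigr),$$ where the sum runs over all non-empty $S\subseteq V(G)$ such that $G[S]$ is connected (single-vertex graphs are connected). $[x^k]\,da(G;x,y)$ denotes the coefficient of $x^k$ in $da(G;x,y)$, which is a polynomial in $y$. The friendship graph $F_n$ is the graph join $nK_2+K_1$, i.e. the disjoint union of $n$ copies of $K_2$ together with one extra vertex adjacent to all other vertices (so it has $2n+1$ vertices). -}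

module Defs where

open import Algebra.Bundles.Raw using (RawMonoid)
open import Data.Fin.Base using (Fin; remQuot; splitAt)
open import Data.Fin.Properties using (_≟_; all?)
open import Data.Fin.Subset using (Subset; inside; outside; _∈_; _∩_; ∁; ∣_∣; Nonempty)
open import Data.Fin.Subset.Properties using (_∈?_; nonempty?)
open import Data.List.Base using (List; []; _∷_; _++_; allFin; filter; foldr; map; replicate)
open import Data.List.Membership.Propositional using () renaming (_∈_ to _∈ˡ_)
open import Data.List.Membership.Propositional.Properties using (∈-allFin)
open import Data.List.Relation.Unary.Any using (here; there)
open import Data.Nat.Base using (ℕ; zero; suc; _+_; _*_; _∸_; _⊓_; +-0-rawMonoid)
open import Data.Product.Base using (_×_; _,_; proj₁; proj₂)
open import Data.Sum.Base using (_⊎_; inj₁; inj₂)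
open import Data.Unit.Base using (⊤; tt)
open import Data.Vec.Base as Vec using ()
open import Function.Base using (_∘_)
open import Function.Bundles using (_↔_; _⇔_; module Inverse)
open import Level using (0ℓ)
open import Relation.Binary.Core using (Rel)
open import Relation.Binary.Construct.Closure.ReflexiveTransitive using (Star; ε; _◅_; _◅◅_)
open import Relation.Binary.Definitions using (Decidable; Symmetric; Irreflexive)
open import Relation.Binary.PropositionalEquality.Core using (_≡_; refl; sym; _≢_)
open import Relation.Nullary.Decidable using (yes; no; does; map′; _×-dec_; _⊎-dec_; _→-dec_; ¬?)
import Relation.Unary as U

record Graph (N : ℕ) : Set₁ where
  infix 4 _~_ _~?_
  field
    _~_      : Rel (Fin N) 0ℓ
    _~?_     : Decidable _~_
    ~-sym    : Symmetric _~_
    ~-irrefl : Irreflexive _≡_ _~_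

record _≅_ {M N : ℕ} (G : Graph M) (H : Graph N) : Set where
  private
    module G = Graph G
    module H = Graph H
  field
    bijection : Fin M ↔ Fin N
  open Inverse bijection using (to)
  field
    adjacency : ∀ u v → u G.~ v ⇔ to u H.~ to v

infix 4 _≅_

complete : ∀ m → Graph m
complete m = record
  { _~_      = _≢_
  ; _~?_     = λ u v → ¬? (u ≟ v)
  ; ~-sym    = _∘ sym
  ; ~-irrefl = λ u≡v u≢v → u≢v u≡v
  }

-- The disjoint union of n copies of G: a vertex is a pair (copy, vertex of G),
-- encoded in Fin (n * m) by remQuot.
copies : ∀ n {m} → Graph m → Graph (n * m)
copies n {m} G = record
  { _~_      = λ u v → copy u ≡ copy v × vertex u ~ vertex v
  ; _~?_     = λ u v → (copy u ≟ copy v) ×-dec (vertex u ~? vertex v)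
  ; ~-sym    = λ (p , q) → sym p , ~-sym q
  ; ~-irrefl = λ { refl (_ , q) → ~-irrefl refl q }
  }
  where
  open Graph G
  copy : Fin (n * m) → Fin n
  copy u = proj₁ (remQuot {n} m u)
  vertex : Fin (n * m) → Fin m
  vertex u = proj₂ (remQuot {n} m u)

module _ {m n : ℕ} (G : Graph m) (H : Graph n) where
  private
    module G = Graph G
    module H = Graph H

  JoinAdj : Rel (Fin m ⊎ Fin n) 0ℓ
  JoinAdj (inj₁ u) (inj₁ v) = u G.~ v
  JoinAdj (inj₁ u) (inj₂ v) = ⊤
  JoinAdj (inj₂ u) (inj₁ v) = ⊤
  JoinAdj (inj₂ u) (inj₂ v) = u H.~ v

  joinAdj? : Decidable JoinAdj
  joinAdj? (inj₁ u) (inj₁ v) = u G.~? v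
  joinAdj? (inj₁ u) (inj₂ v) = yes tt
  joinAdj? (inj₂ u) (inj₁ v) = yes tt
  joinAdj? (inj₂ u) (inj₂ v) = u H.~? v

  joinAdj-sym : ∀ s t → JoinAdj s t → JoinAdj t s
  joinAdj-sym (inj₁ u) (inj₁ v) = G.~-sym
  joinAdj-sym (inj₁ u) (inj₂ v) = λ _ → tt
  joinAdj-sym (inj₂ u) (inj₁ v) = λ _ → tt
  joinAdj-sym (inj₂ u) (inj₂ v) = H.~-sym

  joinAdj-irrefl : Irreflexive _≡_ JoinAdj
  joinAdj-irrefl {inj₁ u} refl = G.~-irrefl refl
  joinAdj-irrefl {inj₂ u} refl = H.~-irrefl refl

  graphJoin : Graph (m + n)
  graphJoin = record
    { _~_      = λ u v → JoinAdj (splitAt m u) (splitAt m v)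
    ; _~?_     = λ u v → joinAdj? (splitAt m u) (splitAt m v)
    ; ~-sym    = λ {u} {v} → joinAdj-sym (splitAt m u) (splitAt m v)
    ; ~-irrefl = λ { {u} refl → joinAdj-irrefl {splitAt m u} refl }
    }

friendship : ∀ n → Graph (n * 2 + 1)
friendship n = graphJoin (copies n (complete 2)) (complete 1)

-- Via ws u v says that u reaches v by an R-path whose interior vertices all lie
-- in ws (Floyd–Warshall).
module _ {N : ℕ} {R : Rel (Fin N) 0ℓ} (R? : Decidable R) where

  private
    Via : List (Fin N) → Rel (Fin N) 0ℓ
    Via []       u v = u ≡ v ⊎ R u v
    Via (w ∷ ws) u v = Via ws u v ⊎ (Via ws u w × Via ws w v)

    via? : ∀ ws → Decidable (Via ws)
    via? []       u v = (u ≟ v) ⊎-dec R? u v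
    via? (w ∷ ws) u v = via? ws u v ⊎-dec (via? ws u w ×-dec via? ws w v)

    via-base : ∀ ws {u v} → u ≡ v ⊎ R u v → Via ws u v
    via-base []       p = p
    via-base (w ∷ ws) p = inj₁ (via-base ws p)

    via-trans : ∀ {ws u v w} → w ∈ˡ ws → Via ws u w → Via ws w v → Via ws u v
    via-trans (here refl) p q = inj₂ (toHead p , fromHead q)
      where
      toHead : ∀ {ws u w} → Via (w ∷ ws) u w → Via ws u w
      toHead (inj₁ p)       = p
      toHead (inj₂ (p , _)) = p
      fromHead : ∀ {ws v w} → Via (w ∷ ws) w v → Via ws w v
      fromHead (inj₁ q)       = q
      fromHead (inj₂ (_ , q)) = q
    via-trans (there i) (inj₁ p)       (inj₁ q)       = inj₁ (via-trans i p q)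
    via-trans (there i) (inj₁ p)       (inj₂ (q , r)) = inj₂ (via-trans i p q , r)
    via-trans (there i) (inj₂ (p , q)) (inj₁ r)       = inj₂ (p , via-trans i q r)
    via-trans (there i) (inj₂ (p , _)) (inj₂ (_ , r)) = inj₂ (p , r)

    via⇒star : ∀ ws {u v} → Via ws u v → Star R u v
    via⇒star []       (inj₁ refl)    = ε
    via⇒star []       (inj₂ r)       = r ◅ ε
    via⇒star (w ∷ ws) (inj₁ p)       = via⇒star ws p
    via⇒star (w ∷ ws) (inj₂ (p , q)) = via⇒star ws p ◅◅ via⇒star ws q

    star⇒via : ∀ {u v} → Star R u v → Via (allFin N) u v
    star⇒via ε        = via-base (allFin N) (inj₁ refl)
    star⇒via (r ◅ rs) =
      via-trans (∈-allFin _) (via-base (allFin N) (inj₂ r)) (star⇒via rs)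

  star? : Decidable (Star R)
  star? u v = map′ (via⇒star (allFin N)) star⇒via (via? (allFin N) u v)

-- Coefficient lists, constant term first.  Trailing zeros are allowed, so
-- equality is coefficientwise.  Coefficients live in an additive monoid, so that
-- iterating the construction gives (ℕ[y])[x].
module Polynomial (M : RawMonoid 0ℓ 0ℓ) where
  open RawMonoid M using () renaming (Carrier to A; _≈_ to _≈ᴬ_; _∙_ to _+ᴬ_; ε to 0ᴬ)

  Poly : Set
  Poly = List A

  coeff : ℕ → Poly → A
  coeff k       []      = 0ᴬ
  coeff zero    (a ∷ p) = a
  coeff (suc k) (a ∷ p) = coeff k p

  infix 4 _≈_
  _≈_ : Rel Poly 0ℓ
  p ≈ q = ∀ k → coeff k p ≈ᴬ coeff k q

  infixl 6 _⊕_
  _⊕_ : Poly → Poly → Poly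
  []      ⊕ q       = q
  (a ∷ p) ⊕ []      = a ∷ p
  (a ∷ p) ⊕ (b ∷ q) = (a +ᴬ b) ∷ (p ⊕ q)

  monomial : A → ℕ → Poly
  monomial a k = replicate k 0ᴬ ++ (a ∷ [])

  sum : List Poly → Poly
  sum = foldr _⊕_ []

  rawMonoid : RawMonoid 0ℓ 0ℓ
  rawMonoid = record { Carrier = Poly ; _≈_ = _≈_ ; _∙_ = _⊕_ ; ε = [] }

module ℕ[y]    = Polynomial +-0-rawMonoid
module ℕ[y][x] = Polynomial ℕ[y].rawMonoid

-- Only applied to non-empty lists; the value at [] is a placeholder.
minimum : List ℕ → ℕ
minimum []       = 0
minimum (k ∷ ks) = foldr _⊓_ k ks

allSubsets : ∀ N → List (Subset N)
allSubsets zero    = Vec.[] ∷ []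
allSubsets (suc N) =
  map (outside Vec.∷_) (allSubsets N) ++ map (inside Vec.∷_) (allSubsets N)

module _ {N : ℕ} (G : Graph N) where
  open Graph G

  neighbours : Fin N → Subset N
  neighbours u = Vec.tabulate (λ v → does (u ~? v))

  δ : Subset N → Fin N → ℕ
  δ S u = ∣ S ∩ neighbours u ∣

  -- The truncated subtraction is exact, since δ (∁ S) u ≤ N.
  f-y : Subset N → ℕ
  f-y S = minimum (map (λ u → δ S u + N ∸ δ (∁ S) u) (filter (_∈? S) (allFin N)))

  -- The adjacency of G[S], kept on the vertex set of G.
  Induced : Subset N → Rel (Fin N) 0ℓ
  Induced S u v = u ∈ S × v ∈ S × u ~ v

  induced? : ∀ S → Decidable (Induced S)
  induced? S u v = (u ∈? S) ×-dec (v ∈? S) ×-dec (u ~? v)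

  Connected : U.Pred (Subset N) 0ℓ
  Connected S = ∀ u → u ∈ S → ∀ v → v ∈ S → Star (Induced S) u v

  connected? : U.Decidable Connected
  connected? S =
    all? λ u → (u ∈? S) →-dec all? λ v → (v ∈? S) →-dec star? (induced? S) u v

  term : Subset N → ℕ[y][x].Poly
  term S = ℕ[y][x].monomial (ℕ[y].monomial 1 (f-y S)) ∣ S ∣

  da : ℕ[y][x].Poly
  da = ℕ[y][x].sum (map term (filter (λ S → nonempty? S ×-dec connected? S) (allSubsets N)))

{-# OPTIONS --safe #-}
module Submission where

-- Only singletons contribute to [x] da(G), so that coefficient is the sum of
-- y^(N − deg u) over the vertices u, i.e. the degree sequence of G. For F_n it is one
-- vertex of degree 2n and 2n vertices of degree 2. Conversely, such a degree sequence
-- gives a vertex adjacent to all others, whose deletion leaves a 1-regular graph on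
-- 2n vertices, which can only be n K₂.

open import Defs
open import Data.Nat.Base using (ℕ; _*_; _∸_; NonZero)
open import Function.Bundles using (_⇔_)

open import Algebra.Bundles.Raw using (RawMonoid)
open import Data.Bool.Base using (Bool; true; false; if_then_else_; not; _∧_)
open import Data.Fin.Base using (Fin; zero; suc; punchIn; splitAt; join)
open import Data.Fin.Permutation
  using (Permutation; _⟨$⟩ʳ_; _⟨$⟩ˡ_; inverseʳ; insert; insert-punchIn; ↔⇒≡; id; flip; _∘ₚ_;
         permutation)
open import Data.Fin.Properties
  using (_≟_; punchIn-punchOut; splitAt-join; join-splitAt)
open import Data.Fin.Subset
  using (Subset; inside; outside; _∩_; ∁; ∣_∣; ⁅_⁆; ⊥; Nonempty)
open import Data.Fin.Subset.Properties
  using (_∈?_; nonempty?; x∈⁅x⁆; x∈⁅y⁆⇒x≡y; ∣⁅x⁆∣≡1)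
open import Data.List.Base using (List; []; _∷_; _++_; map; filter; foldr; allFin)
open import Data.List.Membership.Propositional using () renaming (_∈_ to _∈ˡ_)
open import Data.List.Membership.Propositional.Properties using (∈-allFin; ∈-filter⁺)
open import Data.List.Properties using (map-∘; map-++)
open import Data.List.Relation.Unary.All as All using (All; []; _∷_)
open import Data.List.Relation.Unary.All.Properties using (all-filter)
open import Data.Nat.Base using (zero; suc; _+_; _⊓_; _≤_; z≤n; s≤s; +-0-rawMonoid)
open import Data.Nat.ListAction using () renaming (sum to sumˡ)
open import Data.Nat.ListAction.Properties using (sum-++)
open import Data.Nat.Properties as ℕ
  using (+-0-commutativeMonoid; +-identityʳ; +-comm; *-comm; +-cancelˡ-≡; suc-injective;
         m+n≡0⇒m≡0; m+n≡0⇒n≡0; ⊓-idem; ∸-cancelˡ-≡; m+n∸n≡m; +-mono-≤; n≤1+n)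
open import Data.Product.Base using (∃-syntax; _×_; _,_; proj₁; proj₂)
open import Data.Sum.Base using (inj₁; inj₂) renaming (swap to ⊎-swap)
open import Data.Sum.Properties using (swap-involutive)
open import Data.Vec.Base as Vec using (lookup)
open import Data.Vec.Functional using (removeAt)
open import Data.Vec.Properties using (lookup-zipWith; lookup-map; lookup∘tabulate; []=⇒lookup; lookup⇒[]=)
open import Function.Base using (_∘_)
open import Function.Bundles using (mk⇔)
open import Level using (0ℓ)
open import Relation.Binary.Construct.Closure.ReflexiveTransitive using (ε)
open import Relation.Binary.PropositionalEquality
  using (_≡_; _≢_; refl; sym; trans; cong; cong₂; subst; module ≡-Reasoning)
open import Relation.Nullary using (yes; no; does)
open import Relation.Nullary.Decidable using (_×-dec_; dec-true; dec-false; does-⇔; decidable-stable)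
open import Relation.Nullary.Negation using (contradiction)
import Relation.Unary as U
open import Algebra.Properties.CommutativeMonoid.Sum +-0-commutativeMonoid
  using (sum; sum-remove; sum-permute; sum-cong-≗; sum-replicate-zero)

open ≡-Reasoning

-- Sums of natural numbers over a finite index set.

sum-ones : ∀ n → sum {n} (λ _ → 1) ≡ n
sum-ones zero    = refl
sum-ones (suc n) = cong suc (sum-ones n)

sum-zeros : ∀ {n} (t : Fin n → ℕ) → (∀ i → t i ≡ 0) → sum t ≡ 0
sum-zeros {n} t t≡0 = trans (sum-cong-≗ t≡0) (sum-replicate-zero n)

sum≡0⇒≡0 : ∀ {n} (t : Fin n → ℕ) → sum t ≡ 0 → ∀ i → t i ≡ 0
sum≡0⇒≡0 t eq zero    = m+n≡0⇒m≡0 (t zero) eq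
sum≡0⇒≡0 t eq (suc i) = sum≡0⇒≡0 (t ∘ suc) (m+n≡0⇒n≡0 (t zero) eq) i

sum≢0⇒∃≢0 : ∀ {n} (t : Fin n → ℕ) → sum t ≢ 0 → ∃[ i ] t i ≢ 0
sum≢0⇒∃≢0 {zero}  t ≢0 = contradiction refl ≢0
sum≢0⇒∃≢0 {suc n} t ≢0 with t zero in eq
... | suc _ = zero , λ t₀≡0 → contradiction (trans (sym eq) t₀≡0) λ ()
... | zero  with sum≢0⇒∃≢0 (t ∘ suc) ≢0
...   | i , p = suc i , p

m+n≡1⇒m≡1×n≡0 : ∀ {m n} → m ≢ 0 → m + n ≡ 1 → m ≡ 1 × n ≡ 0
m+n≡1⇒m≡1×n≡0 {zero}        m≢0 _  = contradiction refl m≢0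
m+n≡1⇒m≡1×n≡0 {suc zero}    _   eq = refl , suc-injective eq
m+n≡1⇒m≡1×n≡0 {suc (suc m)} _   ()

-- Some term is nonzero, and it already exhausts the total. Indexing the others by `punchIn`
-- expresses uniqueness; applied to a row of an adjacency matrix, this yields the only neighbour.
sum≡1⇒∃! : ∀ {n} (t : Fin (suc n) → ℕ) → sum t ≡ 1 →
           ∃[ i ] t i ≡ 1 × (∀ j → t (punchIn i j) ≡ 0)
sum≡1⇒∃! t eq =
  let i , tᵢ≢0     = sum≢0⇒∃≢0 t λ ≡0 → contradiction (trans (sym eq) ≡0) λ ()
      tᵢ≡1 , rest≡0 = m+n≡1⇒m≡1×n≡0 tᵢ≢0 (trans (sym (sum-remove {i = i} t)) eq)
  in  i , tᵢ≡1 , sum≡0⇒≡0 (removeAt t i) rest≡0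

sum≤n : ∀ {n} (t : Fin n → ℕ) → (∀ i → t i ≤ 1) → sum t ≤ n
sum≤n {zero}  t t≤1 = z≤n
sum≤n {suc n} t t≤1 = +-mono-≤ (t≤1 zero) (sum≤n (t ∘ suc) (t≤1 ∘ suc))

-- A zero at the head would leave one term too few, each at most 1, to reach the total. This later
-- makes a vertex of full degree adjacent to every other vertex.
sum≡n⇒≡1 : ∀ {n} (t : Fin n → ℕ) → (∀ i → t i ≤ 1) → sum t ≡ n → ∀ i → t i ≡ 1
sum≡n⇒≡1 {suc n} t t≤1 eq i with t zero in t₀≡ | t≤1 zero
... | zero  | _ = contradiction (subst (_≤ n) eq (sum≤n (t ∘ suc) (t≤1 ∘ suc))) ℕ.1+n≰n
sum≡n⇒≡1 {suc n} t t≤1 eq zero    | suc zero | _ = t₀≡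
sum≡n⇒≡1 {suc n} t t≤1 eq (suc i) | suc zero | _ =
  sum≡n⇒≡1 (t ∘ suc) (t≤1 ∘ suc) (suc-injective eq) i
sum≡n⇒≡1 {suc n} t t≤1 eq i | suc (suc _) | s≤s ()

-- Sums over lists and over all subsets of a vertex set.

sumˡ-zeros : ∀ {A : Set} (h : A → ℕ) → (∀ x → h x ≡ 0) → ∀ xs → sumˡ (map h xs) ≡ 0
sumˡ-zeros h h≡0 []       = refl
sumˡ-zeros h h≡0 (x ∷ xs) = cong₂ _+_ (h≡0 x) (sumˡ-zeros h h≡0 xs)

-- Moves the filter into the summand, so that the recursion on `allSubsets` applies.
sumˡ-filter : ∀ {A : Set} {P : U.Pred A 0ℓ} (P? : U.Decidable P) (h : A → ℕ) xs →
              sumˡ (map h (filter P? xs)) ≡ sumˡ (map (λ x → if does (P? x) then h x else 0) xs)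
sumˡ-filter P? h []       = refl
sumˡ-filter P? h (x ∷ xs) with does (P? x)
... | false = sumˡ-filter P? h xs
... | true  = cong (h x +_) (sumˡ-filter P? h xs)

sumˡ-allSubsets-suc : ∀ {N} (h : Subset (suc N) → ℕ) →
  sumˡ (map h (allSubsets (suc N))) ≡
  sumˡ (map (h ∘ (outside Vec.∷_)) (allSubsets N)) +
  sumˡ (map (h ∘ (inside Vec.∷_)) (allSubsets N))
sumˡ-allSubsets-suc {N} h = begin
  sumˡ (map h (map (outside Vec.∷_) Ss ++ map (inside Vec.∷_) Ss))
    ≡⟨ cong sumˡ (map-++ h (map (outside Vec.∷_) Ss) _) ⟩
  sumˡ (map h (map (outside Vec.∷_) Ss) ++ map h (map (inside Vec.∷_) Ss))
    ≡⟨ sum-++ (map h (map (outside Vec.∷_) Ss)) _ ⟩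
  sumˡ (map h (map (outside Vec.∷_) Ss)) + sumˡ (map h (map (inside Vec.∷_) Ss))
    ≡⟨ cong₂ (λ xs ys → sumˡ xs + sumˡ ys) (map-∘ Ss) (map-∘ Ss) ⟨
  sumˡ (map (h ∘ (outside Vec.∷_)) Ss) + sumˡ (map (h ∘ (inside Vec.∷_)) Ss) ∎
  where
  Ss = allSubsets N

sumˡ-allSubsets-⊥ : ∀ {N} (h : Subset N → ℕ) → (∀ S → ∣ S ∣ ≢ 0 → h S ≡ 0) →
                    sumˡ (map h (allSubsets N)) ≡ h ⊥
sumˡ-allSubsets-⊥ {zero}  h h≡0 = +-identityʳ _
sumˡ-allSubsets-⊥ {suc N} h h≡0 = trans (sumˡ-allSubsets-suc h) (trans
  (cong₂ _+_
    (sumˡ-allSubsets-⊥ (h ∘ (outside Vec.∷_)) λ S → h≡0 (outside Vec.∷ S))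
    (sumˡ-zeros (h ∘ (inside Vec.∷_)) (λ S → h≡0 (inside Vec.∷ S) λ ()) (allSubsets N)))
  (+-identityʳ _))

-- Split on membership of vertex `zero`. Sets avoiding it are handled by induction; a set of size
-- one containing it is empty on the remaining vertices.
sumˡ-allSubsets-⁅⁆ : ∀ {N} (h : Subset N → ℕ) → (∀ S → ∣ S ∣ ≢ 1 → h S ≡ 0) →
                     sumˡ (map h (allSubsets N)) ≡ sum (λ u → h ⁅ u ⁆)
sumˡ-allSubsets-⁅⁆ {zero}  h h≡0 = trans (+-identityʳ _) (h≡0 Vec.[] λ ())
sumˡ-allSubsets-⁅⁆ {suc N} h h≡0 = trans (sumˡ-allSubsets-suc h) (trans
  (cong₂ _+_
    (sumˡ-allSubsets-⁅⁆ (h ∘ (outside Vec.∷_)) λ S → h≡0 (outside Vec.∷ S))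
    (sumˡ-allSubsets-⊥ (h ∘ (inside Vec.∷_)) λ S ≢0 → h≡0 (inside Vec.∷ S) (≢0 ∘ suc-injective)))
  (+-comm _ (h ⁅ zero ⁆)))

-- Coefficients of polynomials and generating functions of exponents.

module _ (M : RawMonoid 0ℓ 0ℓ) where
  open RawMonoid M using () renaming (Carrier to A; _∙_ to _+ᴬ_; ε to 0ᴬ)
  open Polynomial M using (coeff; monomial; _⊕_)

  ⊕-identityʳ : ∀ p → p ⊕ [] ≡ p
  ⊕-identityʳ []      = refl
  ⊕-identityʳ (a ∷ p) = refl

  -- Serves both levels, with coefficients in ℕ and in ℕ[y]. A raw monoid carries no laws, so the
  -- identity laws used where one list ends first are passed as propositional equalities.
  coeff-⊕ : (∀ a → 0ᴬ +ᴬ a ≡ a) → (∀ a → a +ᴬ 0ᴬ ≡ a) →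
            ∀ k p q → coeff k (p ⊕ q) ≡ coeff k p +ᴬ coeff k q
  coeff-⊕ idˡ idʳ k       []      q       = sym (idˡ _)
  coeff-⊕ idˡ idʳ k       (a ∷ p) []      = sym (idʳ _)
  coeff-⊕ idˡ idʳ zero    (a ∷ p) (b ∷ q) = refl
  coeff-⊕ idˡ idʳ (suc k) (a ∷ p) (b ∷ q) = coeff-⊕ idˡ idʳ k p q

  coeff-monomial-≡ : ∀ a k → coeff k (monomial a k) ≡ a
  coeff-monomial-≡ a zero    = refl
  coeff-monomial-≡ a (suc k) = coeff-monomial-≡ a k

  coeff-monomial-≢ : ∀ a {k l} → k ≢ l → coeff k (monomial a l) ≡ 0ᴬ
  coeff-monomial-≢ a {zero}  {zero}  k≢l = contradiction refl k≢l
  coeff-monomial-≢ a {suc k} {zero}  k≢l = refl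
  coeff-monomial-≢ a {zero}  {suc l} k≢l = refl
  coeff-monomial-≢ a {suc k} {suc l} k≢l = coeff-monomial-≢ a (k≢l ∘ cong suc)

-- The Kronecker delta of the two exponents.
y^_at_ : ℕ → ℕ → ℕ
y^ l at k = ℕ[y].coeff k (ℕ[y].monomial 1 l)

coeff-⊕-ℕ : ∀ k p q → ℕ[y].coeff k (p ℕ[y].⊕ q) ≡ ℕ[y].coeff k p + ℕ[y].coeff k q
coeff-⊕-ℕ = coeff-⊕ +-0-rawMonoid (λ _ → refl) +-identityʳ

y^≢0 : ∀ k l → y^ l at k ≢ 0 → k ≡ l
y^≢0 k l ≢0 = decidable-stable (k ℕ.≟ l) (≢0 ∘ coeff-monomial-≢ +-0-rawMonoid 1)

sum-y^ : ∀ n l k → sum {n} (λ _ → y^ l at k) ≡ ℕ[y].coeff k (ℕ[y].monomial n l)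
sum-y^ n l k with k ℕ.≟ l
... | yes refl = begin
  sum {n} (λ _ → y^ k at k)            ≡⟨ sum-cong-≗ {n} (λ _ → coeff-monomial-≡ +-0-rawMonoid 1 k) ⟩
  sum {n} (λ _ → 1)                    ≡⟨ sum-ones n ⟩
  n                                    ≡⟨ coeff-monomial-≡ +-0-rawMonoid n k ⟨
  ℕ[y].coeff k (ℕ[y].monomial n k)     ∎
... | no k≢l = trans (sum-zeros {n} _ (λ _ → coeff-monomial-≢ +-0-rawMonoid 1 k≢l))
                     (sym (coeff-monomial-≢ +-0-rawMonoid n k≢l))

coeff-coeff-sum : ∀ j k {A : Set} (t : A → ℕ[y][x].Poly) xs →
  ℕ[y].coeff k (ℕ[y][x].coeff j (ℕ[y][x].sum (map t xs))) ≡
  sumˡ (map (λ x → ℕ[y].coeff k (ℕ[y][x].coeff j (t x))) xs)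
coeff-coeff-sum j k t []       = refl
coeff-coeff-sum j k t (x ∷ xs) = begin
  ℕ[y].coeff k (ℕ[y][x].coeff j (t x ℕ[y][x].⊕ ts))
    ≡⟨ cong (ℕ[y].coeff k) (coeff-⊕ ℕ[y].rawMonoid (λ _ → refl) (⊕-identityʳ +-0-rawMonoid) j (t x) ts) ⟩
  ℕ[y].coeff k (ℕ[y][x].coeff j (t x) ℕ[y].⊕ ℕ[y][x].coeff j ts)
    ≡⟨ coeff-⊕-ℕ k (ℕ[y][x].coeff j (t x)) _ ⟩
  ℕ[y].coeff k (ℕ[y][x].coeff j (t x)) + ℕ[y].coeff k (ℕ[y][x].coeff j ts)
    ≡⟨ cong (_ +_) (coeff-coeff-sum j k t xs) ⟩
  sumˡ (map (λ x → ℕ[y].coeff k (ℕ[y][x].coeff j (t x))) (x ∷ xs)) ∎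
  where
  ts = ℕ[y][x].sum (map t xs)

-- A multiset of exponents is determined by its generating function.
sum-y^-injective : ∀ {m a p q} (f : Fin (suc m) → ℕ) →
  (∀ k → sum (λ i → y^ f i at k) ≡ ℕ[y].coeff k (ℕ[y].monomial a p ℕ[y].⊕ ℕ[y].monomial 1 q)) →
  m ≡ a × ∃[ c ] f c ≡ q × (∀ i → f (punchIn c i) ≡ p)
sum-y^-injective {m} {a} {p} {q} f gf = m≡a , c , fc≡q , rest≡p
  where
  at-q≢0 : sum (λ i → y^ f i at q) ≢ 0
  at-q≢0 ≡0 = contradiction
    (m+n≡0⇒n≡0 (ℕ[y].coeff q (ℕ[y].monomial a p))
      (trans (sym (trans (gf q) (coeff-⊕-ℕ q (ℕ[y].monomial a p) _))) ≡0))
    λ at≡0 → contradiction (trans (sym (coeff-monomial-≡ +-0-rawMonoid 1 q)) at≡0) λ ()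

  nonzero-term : ∃[ i ] y^ f i at q ≢ 0
  nonzero-term = sum≢0⇒∃≢0 (λ i → y^ f i at q) at-q≢0

  c : Fin (suc m)
  c = proj₁ nonzero-term

  fc≡q : f c ≡ q
  fc≡q = sym (y^≢0 q (f c) (proj₂ nonzero-term))

  rest-gf : ∀ k → sum (λ i → y^ f (punchIn c i) at k) ≡ ℕ[y].coeff k (ℕ[y].monomial a p)
  -- Cancelling a single y^q from both sides also covers p = q, which occurs for the triangle, n =
  -- 1.
  rest-gf k = +-cancelˡ-≡ (y^ q at k) _ _ (begin
    y^ q at k + sum (λ i → y^ f (punchIn c i) at k)   ≡⟨ cong (λ l → y^ l at k + sum (λ i → y^ f (punchIn c i) at k)) fc≡q ⟨
    y^ f c at k + sum (λ i → y^ f (punchIn c i) at k) ≡⟨ sum-remove {i = c} (λ i → y^ f i at k) ⟨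
    sum (λ i → y^ f i at k)                           ≡⟨ gf k ⟩
    ℕ[y].coeff k (ℕ[y].monomial a p ℕ[y].⊕ ℕ[y].monomial 1 q)
                                                      ≡⟨ coeff-⊕-ℕ k (ℕ[y].monomial a p) _ ⟩
    ℕ[y].coeff k (ℕ[y].monomial a p) + y^ q at k      ≡⟨ +-comm _ (y^ q at k) ⟩
    y^ q at k + ℕ[y].coeff k (ℕ[y].monomial a p)      ∎)

  rest≡p : ∀ i → f (punchIn c i) ≡ p
  -- At exponent `l` the i-th summand contributes 1, whereas the right-hand side vanishes there if
  -- `l` differs from `p`.
  rest≡p i = decidable-stable (l ℕ.≟ p) λ l≢p → contradiction
    (trans (sym (coeff-monomial-≡ +-0-rawMonoid 1 l))
      (sum≡0⇒≡0 (λ j → y^ f (punchIn c j) at l) (trans (rest-gf l) (coeff-monomial-≢ +-0-rawMonoid a l≢p)) i))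
    λ ()
    where
    l = f (punchIn c i)

  m≡a : m ≡ a
  m≡a = begin
    m                                         ≡⟨ coeff-monomial-≡ +-0-rawMonoid m p ⟨
    ℕ[y].coeff p (ℕ[y].monomial m p)          ≡⟨ sum-y^ m p p ⟨
    sum {m} (λ _ → y^ p at p)                 ≡⟨ sum-cong-≗ (λ i → cong (y^_at p) (rest≡p i)) ⟨
    sum (λ i → y^ f (punchIn c i) at p)       ≡⟨ rest-gf p ⟩
    ℕ[y].coeff p (ℕ[y].monomial a p)          ≡⟨ coeff-monomial-≡ +-0-rawMonoid a p ⟩
    a                                         ∎

-- Degrees and the linear coefficient of the alliance polynomial.

𝟙 : Bool → ℕ
𝟙 b = if b then 1 else 0

𝟙≤1 : ∀ b → 𝟙 b ≤ 1
𝟙≤1 false = z≤n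
𝟙≤1 true  = s≤s z≤n

∣p∣≡sum : ∀ {n} (p : Subset n) → ∣ p ∣ ≡ sum (λ v → 𝟙 (lookup p v))
∣p∣≡sum Vec.[]            = refl
∣p∣≡sum (inside Vec.∷ p)  = cong suc (∣p∣≡sum p)
∣p∣≡sum (outside Vec.∷ p) = ∣p∣≡sum p

lookup-⁅x⁆-≢ : ∀ {n} {x v : Fin n} → v ≢ x → lookup ⁅ x ⁆ v ≡ outside
lookup-⁅x⁆-≢ {x = x} {v} v≢x with lookup ⁅ x ⁆ v in eq
... | outside = refl
... | inside  = contradiction (x∈⁅y⁆⇒x≡y x (lookup⇒[]= v ⁅ x ⁆ eq)) v≢x

-- Membership of `x` rules out the empty list, where `minimum` has only a placeholder value.
minimum-map-constant : ∀ {A : Set} (g : A → ℕ) {x} xs → All (_≡ x) xs → x ∈ˡ xs →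
                       minimum (map g xs) ≡ g x
minimum-map-constant g {x} (_ ∷ xs) (refl ∷ xs≡x) _ = foldr-⊓ xs xs≡x
  where
  foldr-⊓ : ∀ ys → All (_≡ x) ys → foldr _⊓_ (g x) (map g ys) ≡ g x
  foldr-⊓ []       []            = refl
  foldr-⊓ (_ ∷ ys) (refl ∷ ys≡x) = trans (cong (g x ⊓_) (foldr-⊓ ys ys≡x)) (⊓-idem (g x))

module _ {N : ℕ} (G : Graph N) where
  open Graph G

  -- The adjacency matrix with entries in ℕ: degrees become row sums, and deleting a vertex becomes
  -- removing a summand.
  adj : Fin N → Fin N → ℕ
  adj u v = 𝟙 (does (u ~? v))

  degree : Fin N → ℕ
  degree u = sum (adj u)

  ~⇒adj≡1 : ∀ {u v} → u ~ v → adj u v ≡ 1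
  ~⇒adj≡1 {u} {v} u~v = cong 𝟙 (dec-true (u ~? v) u~v)

  adj≡1⇒~ : ∀ {u v} → adj u v ≡ 1 → u ~ v
  adj≡1⇒~ {u} {v} eq with u ~? v
  ... | yes u~v = u~v
  adj≡1⇒~ {u} {v} () | no _

  adj-irrefl : ∀ u → adj u u ≡ 0
  adj-irrefl u = cong 𝟙 (dec-false (u ~? u) (~-irrefl refl))

  adj-sym : ∀ u v → adj u v ≡ adj v u
  adj-sym u v = cong 𝟙 (does-⇔ (mk⇔ ~-sym ~-sym) (u ~? v) (v ~? u))

  degree≤N : ∀ u → degree u ≤ N
  degree≤N u = sum≤n (adj u) (λ v → 𝟙≤1 (does (u ~? v)))

  δ≡sum : ∀ S u → δ G S u ≡ sum (λ v → 𝟙 (lookup S v ∧ does (u ~? v)))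
  δ≡sum S u = trans (∣p∣≡sum (S ∩ neighbours G u)) (sum-cong-≗ λ v →
    cong 𝟙 (trans (lookup-zipWith _∧_ v S _) (cong (lookup S v ∧_) (lookup∘tabulate _ v))))

  δ-⁅u⁆ : ∀ u → δ G ⁅ u ⁆ u ≡ 0
  δ-⁅u⁆ u = trans (δ≡sum ⁅ u ⁆ u) (sum-zeros _ term≡0)
    where
    term≡0 : ∀ v → 𝟙 (lookup ⁅ u ⁆ v ∧ does (u ~? v)) ≡ 0
    term≡0 v with v ≟ u
    ... | no  v≢u  rewrite lookup-⁅x⁆-≢ v≢u = refl
    ... | yes refl rewrite []=⇒lookup (x∈⁅x⁆ u) = adj-irrefl u

  δ-∁⁅u⁆ : ∀ u → δ G (∁ ⁅ u ⁆) u ≡ degree u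
  δ-∁⁅u⁆ u = trans (δ≡sum (∁ ⁅ u ⁆) u) (sum-cong-≗ term≡adj)
    where
    term≡adj : ∀ v → 𝟙 (lookup (∁ ⁅ u ⁆) v ∧ does (u ~? v)) ≡ adj u v
    term≡adj v with v ≟ u
    ... | no  v≢u  rewrite lookup-map v not ⁅ u ⁆ | lookup-⁅x⁆-≢ v≢u = refl
    ... | yes refl rewrite lookup-map u not ⁅ u ⁆ | []=⇒lookup (x∈⁅x⁆ u) = sym (adj-irrefl u)

  -- The minimum ranges over `u` alone. As there are no loops, `u` has no neighbour inside the
  -- singleton and all its neighbours outside.
  f-y-⁅u⁆ : ∀ u → f-y G ⁅ u ⁆ ≡ N ∸ degree u
  f-y-⁅u⁆ u = begin
    f-y G ⁅ u ⁆
      ≡⟨ minimum-map-constant _ (filter (_∈? ⁅ u ⁆) (allFin N))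
           (All.map (x∈⁅y⁆⇒x≡y u) (all-filter (_∈? ⁅ u ⁆) (allFin N)))
           (∈-filter⁺ (_∈? ⁅ u ⁆) (∈-allFin u) (x∈⁅x⁆ u)) ⟩
    δ G ⁅ u ⁆ u + N ∸ δ G (∁ ⁅ u ⁆) u
      ≡⟨ cong₂ (λ d d′ → d + N ∸ d′) (δ-⁅u⁆ u) (δ-∁⁅u⁆ u) ⟩
    N ∸ degree u ∎

  connected-⁅u⁆ : ∀ u → Connected G ⁅ u ⁆
  connected-⁅u⁆ u v v∈ w w∈ with x∈⁅y⁆⇒x≡y u v∈ | x∈⁅y⁆⇒x≡y u w∈
  ... | refl | refl = ε

  -- The term of S is a monomial of x-degree |S|, so only singletons reach x^1, and every singleton
  -- is non-empty and connected.
  [x]da : ∀ k → ℕ[y].coeff k (ℕ[y][x].coeff 1 (da G)) ≡ sum (λ u → y^ (N ∸ degree u) at k)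
  [x]da k = begin
    ℕ[y].coeff k (ℕ[y][x].coeff 1 (da G))
      ≡⟨ coeff-coeff-sum 1 k (term G) (filter P? (allSubsets N)) ⟩
    sumˡ (map c (filter P? (allSubsets N)))
      ≡⟨ sumˡ-filter P? c (allSubsets N) ⟩
    sumˡ (map c′ (allSubsets N))
      ≡⟨ sumˡ-allSubsets-⁅⁆ c′ c′-support ⟩
    sum (λ u → c′ ⁅ u ⁆)
      ≡⟨ sum-cong-≗ c′-⁅u⁆ ⟩
    sum (λ u → y^ (N ∸ degree u) at k) ∎
    where
    P? : U.Decidable (λ S → Nonempty S × Connected G S)
    P? S = nonempty? S ×-dec connected? G S

    c c′ : Subset N → ℕ
    c S  = ℕ[y].coeff k (ℕ[y][x].coeff 1 (term G S))
    c′ S = if does (P? S) then c S else 0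

    c′-support : ∀ S → ∣ S ∣ ≢ 1 → c′ S ≡ 0
    c′-support S ∣S∣≢1 with does (P? S)
    ... | false = refl
    ... | true  = cong (ℕ[y].coeff k) (coeff-monomial-≢ ℕ[y].rawMonoid _ (∣S∣≢1 ∘ sym))

    c′-⁅u⁆ : ∀ u → c′ ⁅ u ⁆ ≡ y^ (N ∸ degree u) at k
    c′-⁅u⁆ u
      rewrite dec-true (P? ⁅ u ⁆) ((u , x∈⁅x⁆ u) , connected-⁅u⁆ u)
            | ∣⁅x⁆∣≡1 u
            | f-y-⁅u⁆ u = refl

-- Isomorphisms as equalities of adjacency matrices.

module _ {M N : ℕ} {G : Graph M} {H : Graph N} where

  fromAdj : (π : Permutation M N) →
            (∀ u v → adj G u v ≡ adj H (π ⟨$⟩ʳ u) (π ⟨$⟩ʳ v)) → G ≅ H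
  fromAdj π eq = record
    { bijection = π
    ; adjacency = λ u v → mk⇔
        (λ u~v → adj≡1⇒~ H (trans (sym (eq u v)) (~⇒adj≡1 G u~v)))
        (λ πu~πv → adj≡1⇒~ G (trans (eq u v) (~⇒adj≡1 H πu~πv)))
    }

  adj-≅ : (iso : G ≅ H) → let π = _≅_.bijection iso in
          ∀ u v → adj G u v ≡ adj H (π ⟨$⟩ʳ u) (π ⟨$⟩ʳ v)
  adj-≅ iso u v = cong 𝟙 (does-⇔ (_≅_.adjacency iso u v) (Graph._~?_ G u v) (Graph._~?_ H _ _))

  degree-≅ : (iso : G ≅ H) → ∀ u → degree G u ≡ degree H (_≅_.bijection iso ⟨$⟩ʳ u)
  degree-≅ iso u = begin
    sum (adj G u)                                   ≡⟨ sum-cong-≗ (adj-≅ iso u) ⟩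
    sum (λ v → adj H (π ⟨$⟩ʳ u) (π ⟨$⟩ʳ v))         ≡⟨ sum-permute (adj H (π ⟨$⟩ʳ u)) π ⟨
    sum (adj H (π ⟨$⟩ʳ u))                          ∎
    where
    π = _≅_.bijection iso

≅-sym : ∀ {M N} {G : Graph M} {H : Graph N} → G ≅ H → H ≅ G
≅-sym {G = G} {H} iso = fromAdj (flip π) λ u v → begin
  adj H u v                                             ≡⟨ cong₂ (adj H) (inverseʳ π) (inverseʳ π) ⟨
  adj H (π ⟨$⟩ʳ (π ⟨$⟩ˡ u)) (π ⟨$⟩ʳ (π ⟨$⟩ˡ v))         ≡⟨ adj-≅ iso _ _ ⟨
  adj G (π ⟨$⟩ˡ u) (π ⟨$⟩ˡ v)                           ∎
  where
  π = _≅_.bijection iso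

≅-trans : ∀ {L M N} {G : Graph L} {H : Graph M} {K : Graph N} → G ≅ H → H ≅ K → G ≅ K
≅-trans iso₁ iso₂ = fromAdj (_≅_.bijection iso₁ ∘ₚ _≅_.bijection iso₂)
  λ u v → trans (adj-≅ iso₁ u v) (adj-≅ iso₂ _ _)

-- Bridges the two vertex orders of the friendship graph, centre last and centre first.
graphJoin-comm : ∀ {m n} (G : Graph m) (H : Graph n) → graphJoin G H ≅ graphJoin H G
graphJoin-comm {m} {n} G H = record
  { bijection = permutation (swap⁺ m n) (swap⁺ n m) (swap⁺-involutive n m) (swap⁺-involutive m n)
  ; adjacency = λ u v → mk⇔ (to u v) (from u v)
  }
  where
  swap⁺ : ∀ m n → Fin (m + n) → Fin (n + m)
  swap⁺ m n = join n m ∘ ⊎-swap ∘ splitAt m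

  splitAt-swap⁺ : ∀ m n u → splitAt n (swap⁺ m n u) ≡ ⊎-swap (splitAt m u)
  splitAt-swap⁺ m n u = splitAt-join n m _

  swap⁺-involutive : ∀ m n u → swap⁺ n m (swap⁺ m n u) ≡ u
  swap⁺-involutive m n u = begin
    join m n (⊎-swap (splitAt n (swap⁺ m n u)))  ≡⟨ cong (join m n ∘ ⊎-swap) (splitAt-swap⁺ m n u) ⟩
    join m n (⊎-swap (⊎-swap (splitAt m u)))     ≡⟨ cong (join m n) (swap-involutive (splitAt m u)) ⟩
    join m n (splitAt m u)                       ≡⟨ join-splitAt m n u ⟩
    u                                            ∎

  joinAdj-swap : ∀ {m n} (G : Graph m) (H : Graph n) s t →
                 JoinAdj G H s t → JoinAdj H G (⊎-swap s) (⊎-swap t)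
  joinAdj-swap G H (inj₁ _) (inj₁ _) p = p
  joinAdj-swap G H (inj₁ _) (inj₂ _) p = p
  joinAdj-swap G H (inj₂ _) (inj₁ _) p = p
  joinAdj-swap G H (inj₂ _) (inj₂ _) p = p

  to : ∀ u v → JoinAdj G H (splitAt m u) (splitAt m v) →
       JoinAdj H G (splitAt n (swap⁺ m n u)) (splitAt n (swap⁺ m n v))
  to u v rewrite splitAt-swap⁺ m n u | splitAt-swap⁺ m n v =
    joinAdj-swap G H (splitAt m u) (splitAt m v)

  from : ∀ u v → JoinAdj H G (splitAt n (swap⁺ m n u)) (splitAt n (swap⁺ m n v)) →
         JoinAdj G H (splitAt m u) (splitAt m v)
  -- Swapping the sides once more gives the converse, since two swaps cancel.
  from u v p rewrite splitAt-swap⁺ m n u | splitAt-swap⁺ m n v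
    with q ← joinAdj-swap H G (⊎-swap (splitAt m u)) (⊎-swap (splitAt m v)) p
    rewrite swap-involutive (splitAt m u) | swap-involutive (splitAt m v) = q

-- Vertex deletion and extension of isomorphisms.

-- Along an injective map this is the induced subgraph on the image; along `punchIn c` it is the
-- graph with `c` deleted.
pullback : ∀ {m n} → (Fin m → Fin n) → Graph n → Graph m
pullback f G = record
  { _~_      = λ u v → f u ~ f v
  ; _~?_     = λ u v → f u ~? f v
  ; ~-sym    = ~-sym
  ; ~-irrefl = ~-irrefl ∘ cong f
  }
  where
  open Graph G

data PunchInView {n} (i : Fin (suc n)) : Fin (suc n) → Set where
  hole    : PunchInView i i
  punched : ∀ j → PunchInView i (punchIn i j)

punchInView : ∀ {n} (i j : Fin (suc n)) → PunchInView i j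
punchInView i j with i ≟ j
... | yes refl = hole
... | no  i≢j  = subst (PunchInView i) (punchIn-punchOut i≢j) (punched _)

insert-hole : ∀ {m n} i j (π : Permutation m n) → insert i j π ⟨$⟩ʳ i ≡ j
insert-hole i j π with i ≟ i
... | yes _  = refl
... | no i≢i = contradiction refl i≢i

module _ {m n} {G : Graph (suc m)} {H : Graph (suc n)} (c : Fin (suc m)) (d : Fin (suc n))
         (iso : pullback (punchIn c) G ≅ pullback (punchIn d) H) where
  private
    π = _≅_.bijection iso

  -- Once the deleted vertices are matched with each other, only their rows remain to be compared:
  -- symmetry gives the columns, and both diagonal entries are 0.
  extend-≅ : (∀ u → adj G c (punchIn c u) ≡ adj H d (punchIn d (π ⟨$⟩ʳ u))) → G ≅ H
  extend-≅ eq = fromAdj (insert c d π) λ u v → adj-insert (punchInView c u) (punchInView c v)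
    where
    adj-insert : ∀ {u v} → PunchInView c u → PunchInView c v →
                 adj G u v ≡ adj H (insert c d π ⟨$⟩ʳ u) (insert c d π ⟨$⟩ʳ v)
    adj-insert hole hole rewrite insert-hole c d π =
      trans (adj-irrefl G c) (sym (adj-irrefl H d))
    adj-insert hole (punched v) rewrite insert-hole c d π | insert-punchIn c d π v = eq v
    adj-insert (punched u) hole rewrite insert-hole c d π | insert-punchIn c d π u =
      trans (adj-sym G _ c) (trans (eq u) (adj-sym H d _))
    adj-insert (punched u) (punched v)
      rewrite insert-punchIn c d π u | insert-punchIn c d π v = adj-≅ iso u v

-- Classification of 1-regular graphs.

module _ {n : ℕ} (H : Graph (suc (suc n))) (degree≡1 : ∀ u → degree H u ≡ 1) where

  -- The diagonal entry is 0, so the degree 1 of vertex `zero` comes entirely from the other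
  -- vertices.
  mate : ∃[ j ] adj H zero (suc j) ≡ 1 × (∀ i → adj H zero (suc (punchIn j i)) ≡ 0)
  mate = sum≡1⇒∃! (adj H zero ∘ suc)
    (trans (cong (_+ sum (adj H zero ∘ suc)) (sym (adj-irrefl H zero))) (degree≡1 zero))

  private
    j : Fin (suc n)
    j = proj₁ mate

  -- The inclusion of what is left after deleting `zero` and its mate.
  unmated : Fin n → Fin (suc (suc n))
  unmated i = suc (punchIn j i)

  degree-split : ∀ u → adj H u zero + (adj H u (suc j) + sum (adj H u ∘ unmated)) ≡ 1
  degree-split u = trans
    (cong (adj H u zero +_) (sym (sum-remove {i = j} (adj H u ∘ suc)))) (degree≡1 u)

  unmated-zero : ∀ i → adj H zero (unmated i) ≡ 0
  unmated-zero = proj₂ (proj₂ mate)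

  -- The edge to `zero` uses up the whole degree of the mate.
  unmated-mate : ∀ i → adj H (suc j) (unmated i) ≡ 0
  unmated-mate = sum≡0⇒≡0 (adj H (suc j) ∘ unmated) (suc-injective (begin
    1 + (0 + sum (adj H (suc j) ∘ unmated))
      ≡⟨ cong₂ (λ a b → a + (b + sum (adj H (suc j) ∘ unmated)))
           (trans (adj-sym H (suc j) zero) (proj₁ (proj₂ mate))) (adj-irrefl H (suc j)) ⟨
    adj H (suc j) zero + (adj H (suc j) (suc j) + sum (adj H (suc j) ∘ unmated))
      ≡⟨ degree-split (suc j) ⟩
    1 ∎))

  -- Neither deleted vertex is adjacent to a remaining one, so no degree drops and the induction can
  -- continue.
  unmated-degree≡1 : ∀ i → degree (pullback unmated H) i ≡ 1
  unmated-degree≡1 i = begin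
    sum (adj H (unmated i) ∘ unmated)
      ≡⟨ cong₂ (λ a b → a + (b + sum (adj H (unmated i) ∘ unmated)))
           (trans (adj-sym H _ zero) (unmated-zero i)) (trans (adj-sym H _ (suc j)) (unmated-mate i)) ⟨
    adj H (unmated i) zero + (adj H (unmated i) (suc j) + sum (adj H (unmated i) ∘ unmated))
      ≡⟨ degree-split (unmated i) ⟩
    1 ∎

1-regular⇒≅copies : ∀ n (H : Graph (n * 2)) → (∀ u → degree H u ≡ 1) → H ≅ copies n (complete 2)
1-regular⇒≅copies zero    H degree≡1 = fromAdj id λ ()
1-regular⇒≅copies (suc n) H degree≡1 =
  -- The matched pair is restored as the first copy of K₂: the inner extension adds the mate of
  -- `zero`, the outer one `zero` itself.
  extend-≅ zero zero (extend-≅ j zero rest (unmated-mate H degree≡1)) zero-row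
  where
  j : Fin (suc (n * 2))
  j = proj₁ (mate H degree≡1)

  K : Graph (suc n * 2)
  K = copies (suc n) (complete 2)

  ih : pullback (unmated H degree≡1) H ≅ copies n (complete 2)
  ih = 1-regular⇒≅copies n _ (unmated-degree≡1 H degree≡1)

  π : Permutation (n * 2) (n * 2)
  π = _≅_.bijection ih

  rest : pullback (punchIn j) (pullback suc H) ≅ pullback suc (pullback suc K)
  -- Without its first copy, `K` tests equality of successors instead of copy indices. The relations
  -- differ but the Boolean tests compute alike, so the matrix equality of `ih` carries over.
  rest = fromAdj π (adj-≅ ih)

  zero-row : ∀ u → adj H zero (suc u) ≡ adj K zero (suc (insert j zero π ⟨$⟩ʳ u))
  zero-row u with punchInView j u
  ... | hole      rewrite insert-hole j zero π = proj₁ (proj₂ (mate H degree≡1))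
  ... | punched v rewrite insert-punchIn j zero π v = unmated-zero H degree≡1 v

-- Degree sequence of the friendship graph and the equivalence.

degree-copies : ∀ n u → degree (copies n (complete 2)) u ≡ 1
degree-copies (suc n) zero          = cong suc (sum-zeros {n * 2} _ λ _ → refl)
degree-copies (suc n) (suc zero)    = cong suc (sum-zeros {n * 2} _ λ _ → refl)
degree-copies (suc n) (suc (suc u)) = degree-copies n u

-- F_n with its centre listed first, so that adjacency to the centre computes.
windmill : ∀ n → Graph (suc (n * 2))
windmill n = graphJoin (complete 1) (copies n (complete 2))

windmill≅friendship : ∀ n → windmill n ≅ friendship n
windmill≅friendship n = graphJoin-comm (complete 1) (copies n (complete 2))

2≤1+n*2 : ∀ n .{{_ : NonZero n}} → 2 ≤ suc (n * 2)
2≤1+n*2 (suc n) = s≤s (s≤s z≤n)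

module _ (n : ℕ) where

  degree-centre : degree (windmill n) zero ≡ n * 2
  degree-centre = sum-ones (n * 2)

  degree-blade : ∀ u → degree (windmill n) (suc u) ≡ 2
  degree-blade u = cong suc (degree-copies n u)

  windmill⇒[x]da : ∀ {N} (G : Graph N) → G ≅ windmill n → ∀ k →
    ℕ[y].coeff k (ℕ[y][x].coeff 1 (da G)) ≡
    ℕ[y].coeff k (ℕ[y].monomial (n * 2) (suc (n * 2) ∸ 2) ℕ[y].⊕ ℕ[y].monomial 1 1)
  windmill⇒[x]da {N} G iso k = begin
    ℕ[y].coeff k (ℕ[y][x].coeff 1 (da G))
      ≡⟨ [x]da G k ⟩
    sum (λ u → y^ (N ∸ degree G u) at k)
      -- The exponent depends on the number of vertices as well as on the degree; the bijection
      -- forces N = 2n + 1.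
      ≡⟨ sum-cong-≗ (λ u → cong₂ (λ l d → y^ (l ∸ d) at k) (↔⇒≡ (_≅_.bijection iso)) (degree-≅ iso u)) ⟩
    sum (λ u → weight (_≅_.bijection iso ⟨$⟩ʳ u))
      ≡⟨ sum-permute weight (_≅_.bijection iso) ⟨
    weight zero + sum (weight ∘ suc)
      ≡⟨ cong₂ _+_
           (cong (λ d → y^ (suc (n * 2) ∸ d) at k) degree-centre)
           (sum-cong-≗ (λ u → cong (λ d → y^ (suc (n * 2) ∸ d) at k) (degree-blade u))) ⟩
    y^ (suc (n * 2) ∸ n * 2) at k + sum {n * 2} (λ _ → y^ (suc (n * 2) ∸ 2) at k)
      ≡⟨ cong₂ _+_ (cong (y^_at k) (m+n∸n≡m 1 (n * 2))) (sum-y^ (n * 2) (suc (n * 2) ∸ 2) k) ⟩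
    y^ 1 at k + ℕ[y].coeff k (ℕ[y].monomial (n * 2) (suc (n * 2) ∸ 2))
      ≡⟨ +-comm (y^ 1 at k) _ ⟩
    ℕ[y].coeff k (ℕ[y].monomial (n * 2) (suc (n * 2) ∸ 2)) + y^ 1 at k
      ≡⟨ coeff-⊕-ℕ k (ℕ[y].monomial (n * 2) (suc (n * 2) ∸ 2)) _ ⟨
    ℕ[y].coeff k (ℕ[y].monomial (n * 2) (suc (n * 2) ∸ 2) ℕ[y].⊕ ℕ[y].monomial 1 1) ∎
    where
    weight : Fin (suc (n * 2)) → ℕ
    weight u = y^ (suc (n * 2) ∸ degree (windmill n) u) at k

  -- Degree 2n among 2n other vertices makes `c` universal. Deleting it lowers every other degree
  -- from 2 to 1, so the rest is n copies of K₂.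
  degrees⇒≅windmill : (G : Graph (suc (n * 2))) (c : Fin (suc (n * 2))) →
    degree G c ≡ n * 2 → (∀ i → degree G (punchIn c i) ≡ 2) → G ≅ windmill n
  degrees⇒≅windmill G c degree-c degree-rest =
    -- `windmill n` without its centre has the same adjacency matrix as the n copies of K₂, so `iso`
    -- is only repackaged.
    extend-≅ c zero (fromAdj (_≅_.bijection iso) (adj-≅ iso)) adj-c
    where
    adj-c : ∀ i → adj G c (punchIn c i) ≡ 1
    adj-c = sum≡n⇒≡1 _ (λ i → 𝟙≤1 _) (begin
      sum (removeAt (adj G c) c)               ≡⟨ cong (_+ sum (removeAt (adj G c) c)) (adj-irrefl G c) ⟨
      adj G c c + sum (removeAt (adj G c) c)   ≡⟨ sum-remove {i = c} (adj G c) ⟨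
      degree G c                               ≡⟨ degree-c ⟩
      n * 2                                    ∎)

    G−c : Graph (n * 2)
    G−c = pullback (punchIn c) G

    degree-G−c : ∀ i → degree G−c i ≡ 1
    degree-G−c i = suc-injective (begin
      1 + degree G−c i                         ≡⟨ cong (_+ degree G−c i) (trans (adj-sym G _ c) (adj-c i)) ⟨
      adj G (punchIn c i) c + degree G−c i     ≡⟨ sum-remove {i = c} (adj G (punchIn c i)) ⟨
      degree G (punchIn c i)                   ≡⟨ degree-rest i ⟩
      2                                        ∎)

    iso : G−c ≅ copies n (complete 2)
    iso = 1-regular⇒≅copies n G−c degree-G−c

  [x]da⇒windmill : ∀ {N} .{{_ : NonZero n}} .{{_ : NonZero N}} (G : Graph N) →
    (∀ k → ℕ[y].coeff k (ℕ[y][x].coeff 1 (da G)) ≡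
           ℕ[y].coeff k (ℕ[y].monomial (n * 2) (suc (n * 2) ∸ 2) ℕ[y].⊕ ℕ[y].monomial 1 1)) →
    G ≅ windmill n
  [x]da⇒windmill {suc m} G eq = reconstruct G
    (sum-y^-injective (λ u → suc m ∸ degree G u) (λ k → trans (sym ([x]da G k)) (eq k)))
    where
    reconstruct : ∀ {m} (G : Graph (suc m)) →
      m ≡ n * 2 × ∃[ c ] suc m ∸ degree G c ≡ 1 ×
        (∀ i → suc m ∸ degree G (punchIn c i) ≡ suc (n * 2) ∸ 2) →
      G ≅ windmill n
    -- Truncated subtraction can be cancelled only below the number of vertices. Degrees satisfy
    -- this bound, and 2 ≤ 2n + 1 is where positivity of n enters.
    reconstruct G (refl , c , codegree-c , codegree-rest) = degrees⇒≅windmill G c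
      (∸-cancelˡ-≡ (degree≤N G c) (n≤1+n _) (trans codegree-c (sym (m+n∸n≡m 1 (n * 2)))))
      (λ i → ∸-cancelˡ-≡ (degree≤N G (punchIn c i)) (2≤1+n*2 n) (codegree-rest i))

proposition36 : (n : ℕ) .{{_ : NonZero n}} {N : ℕ} .{{_ : NonZero N}} (G : Graph N) →
    (G ≅ friendship n) ⇔
    (ℕ[y][x].coeff 1 (da G) ℕ[y].≈ ℕ[y].monomial (2 * n) (2 * n ∸ 1) ℕ[y].⊕ ℕ[y].monomial 1 1)
proposition36 n G = mk⇔
  (λ iso k → trans (windmill⇒[x]da n G (≅-trans iso (≅-sym (windmill≅friendship n))) k) (rhs k))
  (λ eq → ≅-trans ([x]da⇒windmill n G (λ k → trans (eq k) (sym (rhs k)))) (windmill≅friendship n))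
  where
  rhs : ∀ k →
    ℕ[y].coeff k (ℕ[y].monomial (n * 2) (suc (n * 2) ∸ 2) ℕ[y].⊕ ℕ[y].monomial 1 1) ≡
    ℕ[y].coeff k (ℕ[y].monomial (2 * n) (2 * n ∸ 1) ℕ[y].⊕ ℕ[y].monomial 1 1)
  -- `suc l ∸ 2` computes to `l ∸ 1`, so only the order of the factors in 2n has to be changed.
  rhs k = cong (λ l → ℕ[y].coeff k (ℕ[y].monomial l (l ∸ 1) ℕ[y].⊕ ℕ[y].monomial 1 1)) (*-comm n 2)
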